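{- Let $\mathcal O=\langle\mathcal O',\lambda_{\mathsf X}\rangle$ be a satisfiable $\mathsf{PosBool}[\mathsf X]$-annotated $\mathcal{ELHI}^n_\bot$ ontology, annotated by $\lambda_{\mathsf X}:\mathcal O'\to\mathsf X\cup\{1\}$. If (i) $\alpha$ is a BCQ, an assertion, or an RI whose left-hand side is satisfiable w.r.t. $\mathcal O$, or (ii) $\alpha$ is a GCI between basic concepts whose left-hand side is satisfiable w.r.t. $\mathcal O$ and $\mathcal O$ does not contain any GCI with $\top$ as left-hand side, then $$\mathcal P(\alpha,\mathcal O)=\bigvee_{\mathcal J\in\mathsf{Just}(\alpha)}\ \bigwedge_{\beta\in\mathcal J}\lambda_{\mathsf X}(\beta),$$ where $\mathsf{Just}(\alpha)$ denotes the set of all justifications for $\alpha$ w.r.t. $\mathcal O'$.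
   Context: Syntax. Let $\mathsf{N_C},\mathsf{N_R},\mathsf{N_I}$ be mutually disjoint countable sets of concept, role and individual names. A role $P$ is a role name $R\in\mathsf{N_R}$ or an inverse role $R^-$. Concepts: $C::=A\mid\exists P.C\mid C\sqcap C\mid\top$ ($A\in\mathsf{N_C}$); $\exists P$ abbreviates $\exists P.\top$; basic concepts are those of the form $A$ or $\exists P$. $\mathcal{ELHI}^n_\bot$ axioms: assertions $A(a)$, $R(a,b)$; GCIs $C\sqsubseteq D$ with $C::=A\mid\exists P.C\mid C\sqcap C\mid\top$ and $D::=A\mid\exists P.\top\mid\bot$; role inclusions (RIs) $P\sqsubseteq Q$ (positive) and $P\sqcap Q\sqsubseteq\bot$ (negative). An ontology is a finite set of axioms. A BCQ is $\exists\vec y\,\phi(\vec y)$ with $\phi$ a conjunction of atoms $A(t)$, $R(t,t')$, terms in $\mathsf{N_I}\cup\vec y$. Classical interpretations, models, satisfaction and entailment $\models$ are the usual (first-order) ones for description logics. A concept or role $E$ is satisfiable w.r.t. an ontology if $E^{\mathcal I}\neq\emptyset$ for some model $\mathcal I$. Justifications. A justification for $\alpha$ w.r.t. $\mathcal O'$ is a subset $\mathcal J\subseteq\mathcal O'$ that is minimal w.r.t. set inclusion such that $\mathcal J\models\alpha$ (classical entailment). Semiring. $\mathsf X$ is a finite set of variables; $\mathsf{PosBool}[\mathsf X]=(\mathsf{PosBool}[\mathsf X],\vee,\wedge,0,1)$ is the semiring of classes of equivalent positive Boolean expressions over $\mathsf X$ (built with disjunction, conjunction and the constants $0$ (false) and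 $1$ (true), no negation). Annotated semantics ($K=\mathsf{PosBool}[\mathsf X]$, $\oplus=\vee$, $\otimes=\wedge$, $\mathbf 1=1$). $\mathcal O$ is identified with the set of annotated axioms $(\beta,\lambda_{\mathsf X}(\beta))$. A $\mathbb K$-annotated interpretation $\mathcal I$ has a nonempty domain $\Delta^{\mathcal I}$ and maps $a\in\mathsf{N_I}$ to $a^{\mathcal I}\in\Delta^{\mathcal I}$, $A\in\mathsf{N_C}$ to $A^{\mathcal I}\subseteq\Delta^{\mathcal I}\times K$, $R\in\mathsf{N_R}$ to $R^{\mathcal I}\subseteq\Delta^{\mathcal I}\times\Delta^{\mathcal I}\times K$, with $\top^{\mathcal I}=\Delta^{\mathcal I}\times\{\mathbf 1\}$, $\bot^{\mathcal I}=\emptyset$, $(R^-)^{\mathcal I}=\{(e,d,\kappa)\mid(d,e,\kappa)\in R^{\mathcal I}\}$, $(\exists P.C)^{\mathcal I}=\{(d,\kappa\otimes\kappa')\mid\exists e:(d,e,\kappa)\in P^{\mathcal I},(e,\kappa')\in C^{\mathcal I}\}$, $(C\sqcap D)^{\mathcal I}=\{(d,\kappa\otimes\kappa')\mid(d,\kappa)\in C^{\mathcal I},(d,\kappa')\in D^{\mathcal I}\}$, $(P\sqcap Q)^{\mathcal I}=\{(d,e,\kappa\otimes\kappa')\mid(d,e,\kappa)\in P^{\mathcal I},(d,e,\kappa')\in Q^{\mathcal I}\}$. $\mathcal I$ satisfies $(C\sqsubseteq D,\kappa)$ if $(d,\kappa')\in C^{\mathcal I}$ implies $(d,\kappa\otimes\kappa')\in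 D^{\mathcal I}$; $(P\sqsubseteq Q,\kappa)$ if $(d,e,\kappa')\in P^{\mathcal I}$ implies $(d,e,\kappa\otimes\kappa')\in Q^{\mathcal I}$; $(P\sqcap Q\sqsubseteq\bot,\kappa)$ if $(P\sqcap Q)^{\mathcal I}=\emptyset$; $(A(a),\kappa)$ if $(a^{\mathcal I},\kappa)\in A^{\mathcal I}$; $(R(a,b),\kappa)$ if $(a^{\mathcal I},b^{\mathcal I},\kappa)\in R^{\mathcal I}$. $\mathcal I\models(q,\kappa)$ for a BCQ $q$ if there are a map $\pi$ from the terms of $q$ to $\Delta^{\mathcal I}$ with $\pi(c)=c^{\mathcal I}$ for $c\in\mathsf{N_I}$ and, for each atom occurrence $E(\vec t)$ of $q$, some $\kappa_{E(\vec t)}\in K$ with $(\pi(\vec t),\kappa_{E(\vec t)})\in E^{\mathcal I}$, such that $\kappa$ is the $\otimes$-product of all these elements. Models satisfy all annotated axioms; $\mathcal O$ is satisfiable if it has a model; $\mathcal O\models(\alpha,\kappa)$ if every model satisfies $(\alpha,\kappa)$. Provenance. $\mathcal P(\alpha,\mathcal O)=\bigoplus_{\kappa:\ \mathcal O\models(\alpha,\kappa)}\kappa$. Empty disjunctions are $0$ and empty conjunctions are $1$.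
   Formalization: In case (ii) GCIs whose left-hand side is a conjunction of copies of ⊤ (such as ⊤⊓⊤) are excluded along with ⊤; otherwise the claim fails: for O = {(⊤⊓⊤ ⊑ A, x)} and α = B ⊑ A, the provenance is 0 but the right-hand side is x. -}

module Defs where

open import Level using (0ℓ) renaming (suc to lsuc)
open import Axiom.ExcludedMiddle using (ExcludedMiddle)
open import Data.Bool using (Bool; true; false) renaming (_∧_ to _and_; _∨_ to _or_)
open import Data.Bool.Properties using (∨-identityʳ)
open import Data.Empty using (⊥)
open import Data.Fin using (Fin; zero; suc)
open import Data.Fin.Subset using (Subset; inside; outside; _∈_; _⊆_)
open import Data.Fin.Subset.Properties using (_∈?_)
open import Data.List using (List; []; _∷_; [_]; _++_; map; filter; foldr; allFin; cartesianProductWith)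
open import Data.List.Membership.Propositional using () renaming (_∈_ to _∈ˡ_)
open import Data.List.Membership.Propositional.Properties
  using (∈-map⁺; ∈-++⁺ˡ; ∈-++⁺ʳ; ∈-cartesianProductWith⁺)
open import Data.List.Relation.Binary.Pointwise using (Pointwise)
open import Data.List.Relation.Unary.All using (All)
open import Data.List.Relation.Unary.Any using (here; there)
open import Data.Nat using (ℕ; zero; suc)
open import Data.Product using (Σ-syntax; ∃-syntax; _×_; _,_)
open import Data.Sum using (_⊎_; inj₁; inj₂; [_,_]′)
open import Data.Unit using (⊤)
open import Data.Vec using (Vec; []; _∷_; lookup)
open import Function using (_↣_; Injective)
open import Relation.Binary.PropositionalEquality using (_≡_; refl; sym; trans; cong₂)
open import Relation.Nullary using (¬_)

------------------------------------------------------------------------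
-- The semiring PosBool[X], for X = Fin n

infixr 6 _∨_
infixr 7 _∧_
infix  4 _≈_

data PosBool (n : ℕ) : Set where
  var     : Fin n → PosBool n
  0# 1#   : PosBool n
  _∨_ _∧_ : PosBool n → PosBool n → PosBool n

⟦_⟧ : ∀ {n} → PosBool n → Vec Bool n → Bool
⟦ var x ⟧  v = lookup v x
⟦ 0# ⟧     v = false
⟦ 1# ⟧     v = true
⟦ κ ∨ κ′ ⟧ v = ⟦ κ ⟧ v or ⟦ κ′ ⟧ v
⟦ κ ∧ κ′ ⟧ v = ⟦ κ ⟧ v and ⟦ κ′ ⟧ v

-- The elements of the semiring are the expressions up to _≈_.
_≈_ : ∀ {n} → PosBool n → PosBool n → Set
κ ≈ κ′ = ∀ v → ⟦ κ ⟧ v ≡ ⟦ κ′ ⟧ v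

⋁ ⋀ : ∀ {n} → List (PosBool n) → PosBool n
⋁ = foldr _∨_ 0#
⋀ = foldr _∧_ 1#

weaken : ∀ {n} → PosBool n → PosBool (suc n)
weaken (var x)  = var (suc x)
weaken 0#       = 0#
weaken 1#       = 1#
weaken (κ ∨ κ′) = weaken κ ∨ weaken κ′
weaken (κ ∧ κ′) = weaken κ ∧ weaken κ′

-- Every expression κ is equivalent to κ[x:=0] ∨ (x ∧ κ[x:=1]), since κ
-- is monotone.
shannon : ∀ {n} → PosBool n → PosBool n → PosBool (suc n)
shannon κ₀ κ₁ = weaken κ₀ ∨ (var zero ∧ weaken κ₁)

-- A finite list of representatives of all classes (see classes-complete);
-- a class may be represented more than once.
classes : ∀ n → List (PosBool n)
classes zero    = 0# ∷ 1# ∷ []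
classes (suc n) = cartesianProductWith shannon (classes n) (classes n)

private
  cofactor : ∀ {n} → Bool → PosBool (suc n) → PosBool n
  cofactor b (var (suc x))  = var x
  cofactor false (var zero) = 0#
  cofactor true  (var zero) = 1#
  cofactor b 0#             = 0#
  cofactor b 1#             = 1#
  cofactor b (κ ∨ κ′)       = cofactor b κ ∨ cofactor b κ′
  cofactor b (κ ∧ κ′)       = cofactor b κ ∧ cofactor b κ′

  ⟦cofactor⟧ : ∀ {n} b (κ : PosBool (suc n)) v → ⟦ cofactor b κ ⟧ v ≡ ⟦ κ ⟧ (b ∷ v)
  ⟦cofactor⟧ false (var zero) v = refl
  ⟦cofactor⟧ true  (var zero) v = refl
  ⟦cofactor⟧ b (var (suc x)) v  = refl
  ⟦cofactor⟧ b 0# v             = refl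
  ⟦cofactor⟧ b 1# v             = refl
  ⟦cofactor⟧ b (κ ∨ κ′) v       = cong₂ _or_ (⟦cofactor⟧ b κ v) (⟦cofactor⟧ b κ′ v)
  ⟦cofactor⟧ b (κ ∧ κ′) v       = cong₂ _and_ (⟦cofactor⟧ b κ v) (⟦cofactor⟧ b κ′ v)

  ⟦weaken⟧ : ∀ {n} (κ : PosBool n) b v → ⟦ weaken κ ⟧ (b ∷ v) ≡ ⟦ κ ⟧ v
  ⟦weaken⟧ (var x) b v  = refl
  ⟦weaken⟧ 0# b v       = refl
  ⟦weaken⟧ 1# b v       = refl
  ⟦weaken⟧ (κ ∨ κ′) b v = cong₂ _or_ (⟦weaken⟧ κ b v) (⟦weaken⟧ κ′ b v)
  ⟦weaken⟧ (κ ∧ κ′) b v = cong₂ _and_ (⟦weaken⟧ κ b v) (⟦weaken⟧ κ′ b v)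

  or-absorb : ∀ a b c d → a or b ≡ b → c or d ≡ d → (a or c) or (b or d) ≡ b or d
  or-absorb true  true  c     d _ _ = refl
  or-absorb false true  true  d _ _ = refl
  or-absorb false true  false d _ _ = refl
  or-absorb false false c     d _ q = q

  and-absorb : ∀ a b c d → a or b ≡ b → c or d ≡ d → (a and c) or (b and d) ≡ b and d
  and-absorb true  true  c d _ q = q
  and-absorb false b     c d _ _ = refl

  monotone : ∀ {n} (κ : PosBool (suc n)) v →
             ⟦ κ ⟧ (false ∷ v) or ⟦ κ ⟧ (true ∷ v) ≡ ⟦ κ ⟧ (true ∷ v)
  monotone (var zero) v    = refl
  monotone (var (suc x)) v with lookup v x
  ... | true  = refl
  ... | false = refl
  monotone 0# v       = refl
  monotone 1# v       = refl
  monotone (κ ∨ κ′) v = or-absorb (⟦ κ ⟧ (false ∷ v)) _ _ _ (monotone κ v) (monotone κ′ v)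
  monotone (κ ∧ κ′) v = and-absorb (⟦ κ ⟧ (false ∷ v)) _ _ _ (monotone κ v) (monotone κ′ v)

classes-complete : ∀ {n} (κ : PosBool n) → ∃[ κ′ ] (κ′ ∈ˡ classes n × κ ≈ κ′)
classes-complete {zero} κ with ⟦ κ ⟧ [] in eq
... | false = 0# , here refl , λ { [] → eq }
... | true  = 1# , there (here refl) , λ { [] → eq }
classes-complete {suc n} κ
  with κ₀ , κ₀∈ , κ≈₀ ← classes-complete (cofactor false κ)
     | κ₁ , κ₁∈ , κ≈₁ ← classes-complete (cofactor true κ)
  = shannon κ₀ κ₁ , ∈-cartesianProductWith⁺ shannon κ₀∈ κ₁∈ , equiv
  where
  at : ∀ b κ″ → cofactor b κ ≈ κ″ → ∀ b′ v → ⟦ weaken κ″ ⟧ (b′ ∷ v) ≡ ⟦ κ ⟧ (b ∷ v)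
  at b κ″ e b′ v = trans (⟦weaken⟧ κ″ b′ v) (trans (sym (e v)) (⟦cofactor⟧ b κ v))

  equiv : κ ≈ shannon κ₀ κ₁
  equiv (false ∷ v) = sym (trans (∨-identityʳ _) (at false κ₀ κ≈₀ false v))
  equiv (true ∷ v)  = sym (trans (cong₂ _or_ (at false κ₀ κ≈₀ true v) (at true κ₁ κ≈₁ true v))
                                 (monotone κ v))

subsets : ∀ m → List (Subset m)
subsets zero    = [ [] ]
subsets (suc m) = map (outside ∷_) (subsets m) ++ map (inside ∷_) (subsets m)

subsets-complete : ∀ {m} (J : Subset m) → J ∈ˡ subsets m
subsets-complete []            = here refl
subsets-complete (outside ∷ J) = ∈-++⁺ˡ (∈-map⁺ (outside ∷_) (subsets-complete J))
subsets-complete (inside ∷ J)  = ∈-++⁺ʳ _ (∈-map⁺ (inside ∷_) (subsets-complete J))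

------------------------------------------------------------------------
-- Syntax

record Signature : Set₁ where
  field
    NC NR NI     : Set
    NC-countable : NC ↣ ℕ
    NR-countable : NR ↣ ℕ
    NI-countable : NI ↣ ℕ

open Signature

data Role (S : Signature) : Set where
  name : NR S → Role S
  _⁻   : NR S → Role S

infixr 7 _⊓_

data Concept (S : Signature) : Set where
  name  : NC S → Concept S
  ∃′_∙_ : Role S → Concept S → Concept S
  _⊓_   : Concept S → Concept S → Concept S
  ⊤′    : Concept S

data Basic (S : Signature) : Set where
  name : NC S → Basic S
  ∃′_  : Role S → Basic S

⌜_⌝ : ∀ {S} → Basic S → Concept S
⌜ name A ⌝ = name A
⌜ ∃′ P ⌝   = ∃′ P ∙ ⊤′

data Rhs (S : Signature) : Set where
  basic : Basic S → Rhs S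
  ⊥′    : Rhs S

data Axiom (S : Signature) : Set where
  conceptAssertion : NC S → NI S → Axiom S
  roleAssertion    : NR S → NI S → NI S → Axiom S
  gci              : Concept S → Rhs S → Axiom S
  ri               : Role S → Role S → Axiom S
  negRi            : Role S → Role S → Axiom S      -- P ⊓ Q ⊑ ⊥

Term : Signature → ℕ → Set
Term S k = NI S ⊎ Fin k

data Atom (S : Signature) (k : ℕ) : Set where
  conceptAtom : NC S → Term S k → Atom S k
  roleAtom    : NR S → Term S k → Term S k → Atom S k

record BCQ (S : Signature) : Set where
  field
    arity : ℕ      -- number of existentially quantified variables
    atoms : List (Atom S arity)

data Query (S : Signature) : Set where
  axiom : Axiom S → Query S
  bcq   : BCQ S → Query S

record Ontology (S : Signature) : Set where
  field
    size      : ℕ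
    axiomAt   : Fin size → Axiom S
    injective : Injective _≡_ _≡_ axiomAt

data Label (n : ℕ) : Set where
  var : Fin n → Label n
  one : Label n

⟪_⟫ : ∀ {n} → Label n → PosBool n
⟪ var x ⟫ = var x
⟪ one ⟫   = 1#

record AnnotatedOntology (S : Signature) (n : ℕ) : Set where
  field
    ontology : Ontology S
    label    : Fin (Ontology.size ontology) → Label n
  open Ontology ontology public

------------------------------------------------------------------------
-- Classical semantics

record Interpretation (S : Signature) : Set₁ where
  field
    Δ          : Set
    nonempty   : Δ
    individual : NI S → Δ
    concept    : NC S → Δ → Set
    role       : NR S → Δ → Δ → Set

  roleExt : Role S → Δ → Δ → Set
  roleExt (name R) d e = role R d e
  roleExt (R ⁻)    d e = role R e d

  conceptExt : Concept S → Δ → Set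
  conceptExt (name A)   d = concept A d
  conceptExt (∃′ P ∙ C) d = Σ[ e ∈ Δ ] (roleExt P d e × conceptExt C e)
  conceptExt (C ⊓ D)    d = conceptExt C d × conceptExt D d
  conceptExt ⊤′         d = ⊤

  rhsExt : Rhs S → Δ → Set
  rhsExt (basic B) d = conceptExt ⌜ B ⌝ d
  rhsExt ⊥′        d = ⊥

  term : ∀ {k} → (Fin k → Δ) → Term S k → Δ
  term π = [ individual , π ]′

  atomHolds : ∀ {k} → (Fin k → Δ) → Atom S k → Set
  atomHolds π (conceptAtom A t) = concept A (term π t)
  atomHolds π (roleAtom R t t′) = role R (term π t) (term π t′)

_⊨_ : ∀ {S} → Interpretation S → Query S → Set
I ⊨ axiom (conceptAssertion A a) = concept A (individual a)
  where open Interpretation I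
I ⊨ axiom (roleAssertion R a b) = role R (individual a) (individual b)
  where open Interpretation I
I ⊨ axiom (gci C D) = ∀ d → conceptExt C d → rhsExt D d
  where open Interpretation I
I ⊨ axiom (ri P Q) = ∀ d e → roleExt P d e → roleExt Q d e
  where open Interpretation I
I ⊨ axiom (negRi P Q) = ∀ d e → ¬ (roleExt P d e × roleExt Q d e)
  where open Interpretation I
I ⊨ bcq q = Σ[ π ∈ (Fin (BCQ.arity q) → Δ) ] All (atomHolds π) (BCQ.atoms q)
  where open Interpretation I

Entails : ∀ {S} (O : Ontology S) → Subset (Ontology.size O) → Query S → Set₁
Entails {S} O J α =
  ∀ (I : Interpretation S) → (∀ i → i ∈ J → I ⊨ axiom (Ontology.axiomAt O i)) → I ⊨ α

IsJustification : ∀ {S} (O : Ontology S) → Query S → Subset (Ontology.size O) → Set₁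
IsJustification O α J = Entails O J α × (∀ J′ → J′ ⊆ J → Entails O J′ α → J′ ≡ J)

------------------------------------------------------------------------
-- Annotated semantics

-- Subsets of Δ × PosBool[X] are predicates on expressions that respect _≈_.
record AnnInterpretation (S : Signature) (n : ℕ) : Set₁ where
  field
    Δ            : Set
    nonempty     : Δ
    individual   : NI S → Δ
    concept      : NC S → Δ → PosBool n → Set
    role         : NR S → Δ → Δ → PosBool n → Set
    concept-resp : ∀ {A d κ κ′} → κ ≈ κ′ → concept A d κ → concept A d κ′
    role-resp    : ∀ {R d e κ κ′} → κ ≈ κ′ → role R d e κ → role R d e κ′

  roleExt : Role S → Δ → Δ → PosBool n → Set
  roleExt (name R) d e κ = role R d e κ
  roleExt (R ⁻)    d e κ = role R e d κ

  roleConjExt : Role S → Role S → Δ → Δ → PosBool n → Set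
  roleConjExt P Q d e κ =
    ∃[ κ₁ ] ∃[ κ₂ ] (κ ≈ κ₁ ∧ κ₂ × roleExt P d e κ₁ × roleExt Q d e κ₂)

  conceptExt : Concept S → Δ → PosBool n → Set
  conceptExt (name A)   d κ = concept A d κ
  conceptExt (∃′ P ∙ C) d κ =
    Σ[ e ∈ Δ ] ∃[ κ₁ ] ∃[ κ₂ ] (κ ≈ κ₁ ∧ κ₂ × roleExt P d e κ₁ × conceptExt C e κ₂)
  conceptExt (C ⊓ D)    d κ =
    ∃[ κ₁ ] ∃[ κ₂ ] (κ ≈ κ₁ ∧ κ₂ × conceptExt C d κ₁ × conceptExt D d κ₂)
  conceptExt ⊤′         d κ = κ ≈ 1#

  rhsExt : Rhs S → Δ → PosBool n → Set
  rhsExt (basic B) d κ = conceptExt ⌜ B ⌝ d κ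
  rhsExt ⊥′        d κ = ⊥

  term : ∀ {k} → (Fin k → Δ) → Term S k → Δ
  term π = [ individual , π ]′

  atomHolds : ∀ {k} → (Fin k → Δ) → Atom S k → PosBool n → Set
  atomHolds π (conceptAtom A t) κ = concept A (term π t) κ
  atomHolds π (roleAtom R t t′) κ = role R (term π t) (term π t′) κ

_⊨ₐ_,_ : ∀ {S n} → AnnInterpretation S n → Query S → PosBool n → Set
I ⊨ₐ axiom (conceptAssertion A a) , κ = concept A (individual a) κ
  where open AnnInterpretation I
I ⊨ₐ axiom (roleAssertion R a b) , κ = role R (individual a) (individual b) κ
  where open AnnInterpretation I
I ⊨ₐ axiom (gci C D) , κ = ∀ d κ′ → conceptExt C d κ′ → rhsExt D d (κ ∧ κ′)
  where open AnnInterpretation I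
I ⊨ₐ axiom (ri P Q) , κ = ∀ d e κ′ → roleExt P d e κ′ → roleExt Q d e (κ ∧ κ′)
  where open AnnInterpretation I
I ⊨ₐ axiom (negRi P Q) , κ = ∀ d e κ′ → ¬ roleConjExt P Q d e κ′
  where open AnnInterpretation I
-- κs lists one annotation per atom occurrence.
I ⊨ₐ bcq q , κ =
  Σ[ π ∈ (Fin (BCQ.arity q) → Δ) ] ∃[ κs ] (Pointwise (atomHolds π) (BCQ.atoms q) κs × κ ≈ ⋀ κs)
  where open AnnInterpretation I

module _ {S : Signature} {n : ℕ} (O : AnnotatedOntology S n) where
  open AnnotatedOntology O

  IsModel : AnnInterpretation S n → Set
  IsModel I = ∀ i → I ⊨ₐ axiom (axiomAt i) , ⟪ label i ⟫

  Satisfiable : Set₁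
  Satisfiable = Σ[ I ∈ AnnInterpretation S n ] IsModel I

  AnnEntails : Query S → PosBool n → Set₁
  AnnEntails α κ = ∀ I → IsModel I → I ⊨ₐ α , κ

  SatisfiableConcept : Concept S → Set₁
  SatisfiableConcept C =
    Σ[ I ∈ AnnInterpretation S n ]
      (IsModel I × ∃[ d ] ∃[ κ ] AnnInterpretation.conceptExt I C d κ)

  SatisfiableRole : Role S → Set₁
  SatisfiableRole P =
    Σ[ I ∈ AnnInterpretation S n ]
      (IsModel I × ∃[ d ] ∃[ e ] ∃[ κ ] AnnInterpretation.roleExt I P d e κ)

  SatisfiableRoleConj : Role S → Role S → Set₁
  SatisfiableRoleConj P Q =
    Σ[ I ∈ AnnInterpretation S n ]
      (IsModel I × ∃[ d ] ∃[ e ] ∃[ κ ] AnnInterpretation.roleConjExt I P Q d e κ)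

-- Conjunctions are read modulo C ⊓ ⊤ = C = ⊤ ⊓ C, so that ⊤ ⊓ ⊤ counts as ⊤.
data IsTop {S : Signature} : Concept S → Set where
  top  : IsTop ⊤′
  conj : ∀ {C D} → IsTop C → IsTop D → IsTop (C ⊓ D)

NoTopGCI : ∀ {S} → Ontology S → Set
NoTopGCI O = ∀ i C D → Ontology.axiomAt O i ≡ gci C D → ¬ IsTop C

data Admissible {S n} (O : AnnotatedOntology S n) : Query S → Set₁ where
  bcq : ∀ q → Admissible O (bcq q)
  conceptAssertion : ∀ A a → Admissible O (axiom (conceptAssertion A a))
  roleAssertion : ∀ R a b → Admissible O (axiom (roleAssertion R a b))
  ri : ∀ P Q → SatisfiableRole O P → Admissible O (axiom (ri P Q))
  negRi : ∀ P Q → SatisfiableRoleConj O P Q → Admissible O (axiom (negRi P Q))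
  gci : ∀ B B′ → SatisfiableConcept O ⌜ B ⌝ → NoTopGCI (AnnotatedOntology.ontology O) →
        Admissible O (axiom (gci ⌜ B ⌝ (basic B′)))

------------------------------------------------------------------------
-- Provenance and justifications

-- Excluded middle turns the subsets {κ ∣ O ⊨ (α,κ)} and Just(α) of finite
-- sets into finite lists.  Repetitions in the former are harmless since _∨_
-- is idempotent.
module _ (em : ExcludedMiddle (lsuc 0ℓ)) {S : Signature} where

  𝒫 : ∀ {n} → Query S → AnnotatedOntology S n → PosBool n
  𝒫 α O = ⋁ (filter (λ κ → em {AnnEntails O α κ}) (classes _))

  Just : (O : Ontology S) → Query S → List (Subset (Ontology.size O))
  Just O α = filter (λ J → em {IsJustification O α J}) (subsets _)

⋀label : ∀ {S n} (O : AnnotatedOntology S n) → Subset (AnnotatedOntology.size O) → PosBool n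
⋀label O J = ⋀ (map (λ i → ⟪ label i ⟫) (filter (_∈? J) (allFin size)))
  where open AnnotatedOntology O

{-# OPTIONS --safe #-}

-- Fix a valuation v and let O_v consist of the axioms whose label is true
-- under v.  The right-hand side is true under v iff O_v classically entails α,
-- so it suffices to show that this holds iff O ⊨ (α,κ) for some κ true under v.
--
-- From annotated to classical: multiply a classical model I of O_v by the
-- classical projection M of an annotated model of O, and annotate a fact over
-- (d,m) with κ whenever it holds at m in M, and at d in I in case κ is true
-- under v.  The factor M takes care of the negative axioms outside O_v.
--
-- From classical to annotated: otherwise there is a countermodel to (α,κ) for
-- every κ true under v.  Their product is a model of O, and the facts annotated
-- with some κ true under v form a classical model of O_v.  Hence α holds there,
-- which the component at the annotation of α refutes.  For inclusions, every
-- countermodel (d annotated with κ₀ on the left-hand side, but not with κ ∧ κ₀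
-- on the right-hand side) is reannotated beforehand, so that the left-hand
-- side gets annotation 1 and the counterexamples can be tupled.

module Submission where

open import Defs
open import Level using (lift; lower; 0ℓ) renaming (suc to lsuc)
open import Algebra.Bundles using (CommutativeMonoid)
open import Algebra.Properties.CommutativeSemigroup using (interchange)
open import Axiom.ExcludedMiddle using (ExcludedMiddle)
open import Data.Bool using (Bool; true; false; if_then_else_) renaming (_∧_ to _and_; _∨_ to _or_)
open import Data.Bool.Properties
  using (∧-assoc; ∧-comm; ∧-identityʳ; ∧-idem; ∧-conicalˡ; ∧-conicalʳ; ∨-zeroʳ;
         ∧-commutativeMonoid; ⇔→≡)
open import Data.Fin using (Fin)
open import Data.Fin.Subset using (Subset; _∈_; _⊆_; _⊂_)
open import Data.Fin.Subset.Induction using (⊂-wellFounded)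
open import Data.Fin.Subset.Properties using (_∈?_; ⊆-antisym; ⊆-refl; ⊆-trans; p⊂q⇒p⊆q)
open import Data.List using (List; []; _∷_; allFin; filter; map)
open import Data.List.Membership.Propositional using (find; lose)
open import Data.List.Membership.Propositional.Properties using (∈-filter⁺; ∈-filter⁻; ∈-allFin)
open import Data.List.Relation.Binary.Pointwise using (Pointwise; []; _∷_)
open import Data.List.Relation.Unary.All using (All; []; _∷_)
import Data.List.Relation.Unary.All as All
import Data.List.Relation.Unary.All.Properties as All
open import Data.List.Relation.Unary.Any using (Any; here; there)
import Data.List.Relation.Unary.Any.Properties as Any
open import Data.Nat using (ℕ)
open import Data.Product using (Σ-syntax; ∃-syntax; _×_; _,_; proj₁; proj₂)
open import Data.Sum using (_⊎_; inj₁; inj₂)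
open import Data.Unit using (⊤; tt)
open import Data.Vec using (Vec; tabulate)
open import Data.Vec.Properties using (lookup∘tabulate; lookup⇒[]=; []=⇒lookup)
open import Function using (id; _∘_; mk⇔)
open import Induction.WellFounded using (Acc; acc)
open import Relation.Binary.PropositionalEquality using (_≡_; _≗_; refl; sym; trans; cong; cong₂)
open import Relation.Nullary using (¬_; yes; no; contradiction; map′; decidable-stable)

private module 𝔸 = AnnInterpretation
private module ℂ = Interpretation

-- Truth of positive Boolean expressions under a valuation.

infix 4 _⊩_

_⊩_ : ∀ {n} → Vec Bool n → PosBool n → Set
v ⊩ κ = ⟦ κ ⟧ v ≡ true

module _ {n : ℕ} where

  -- On truth functions rather than expressions, since unification cannot
  -- recover κ from ⟦ κ ⟧.
  ≈-sym : {f g : Vec Bool n → Bool} → f ≗ g → g ≗ f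
  ≈-sym p v = sym (p v)

  ≈-trans : {f g h : Vec Bool n → Bool} → f ≗ g → g ≗ h → f ≗ h
  ≈-trans p q v = trans (p v) (q v)

  ∧-cong-≈ : {f f′ g g′ : Vec Bool n → Bool} → f ≗ f′ → g ≗ g′ →
             (λ v → f v and g v) ≗ (λ v → f′ v and g′ v)
  ∧-cong-≈ p q v = cong₂ _and_ (p v) (q v)

  ∧-congˡ-≈ : {f f′ : Vec Bool n → Bool} (κ : PosBool n) → f ≗ f′ →
              (λ v → f v and ⟦ κ ⟧ v) ≗ (λ v → f′ v and ⟦ κ ⟧ v)
  ∧-congˡ-≈ κ p v = cong (_and ⟦ κ ⟧ v) (p v)

  ∧-congʳ-≈ : {g g′ : Vec Bool n → Bool} (κ : PosBool n) → g ≗ g′ →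
              (λ v → ⟦ κ ⟧ v and g v) ≗ (λ v → ⟦ κ ⟧ v and g′ v)
  ∧-congʳ-≈ κ p v = cong (⟦ κ ⟧ v and_) (p v)

  ∧-assoc-≈ : (κ₁ κ₂ κ₃ : PosBool n) → (κ₁ ∧ κ₂) ∧ κ₃ ≈ κ₁ ∧ (κ₂ ∧ κ₃)
  ∧-assoc-≈ κ₁ κ₂ κ₃ v = ∧-assoc (⟦ κ₁ ⟧ v) _ _

  ∧-comm-≈ : (κ₁ κ₂ : PosBool n) → κ₁ ∧ κ₂ ≈ κ₂ ∧ κ₁
  ∧-comm-≈ κ₁ κ₂ v = ∧-comm (⟦ κ₁ ⟧ v) _

  ∧-identityˡ-≈ : (κ : PosBool n) → 1# ∧ κ ≈ κ
  ∧-identityˡ-≈ κ v = refl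

  ∧-identityʳ-≈ : (κ : PosBool n) → κ ∧ 1# ≈ κ
  ∧-identityʳ-≈ κ v = ∧-identityʳ _

  ∧-idem-≈ : (κ : PosBool n) → κ ∧ κ ≈ κ
  ∧-idem-≈ κ v = ∧-idem _

  ∧-interchange-≈ : (κ₁ κ₂ δ₁ δ₂ : PosBool n) → (κ₁ ∧ κ₂) ∧ (δ₁ ∧ δ₂) ≈ (κ₁ ∧ δ₁) ∧ (κ₂ ∧ δ₂)
  ∧-interchange-≈ κ₁ κ₂ δ₁ δ₂ v =
    interchange (CommutativeMonoid.commutativeSemigroup ∧-commutativeMonoid) (⟦ κ₁ ⟧ v) _ _ _

  ⊩-∧ : ∀ {v} (κ κ′ : PosBool n) → v ⊩ κ → v ⊩ κ′ → v ⊩ κ ∧ κ′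
  ⊩-∧ κ κ′ = cong₂ _and_

  ⊩-⋁⁺ : ∀ {v} {κs : List (PosBool n)} → Any (v ⊩_) κs → v ⊩ ⋁ κs
  ⊩-⋁⁺ {v} (here {xs = κs} p) = cong (_or ⟦ ⋁ κs ⟧ v) p
  ⊩-⋁⁺ {v} (there {x = κ} p)  = trans (cong (⟦ κ ⟧ v or_) (⊩-⋁⁺ p)) (∨-zeroʳ _)

  ⊩-⋁⁻ : ∀ {v} (κs : List (PosBool n)) → v ⊩ ⋁ κs → Any (v ⊩_) κs
  ⊩-⋁⁻ {v} (κ ∷ κs) p with ⟦ κ ⟧ v in eq
  ... | true  = here eq
  ... | false = there (⊩-⋁⁻ κs p)

  ⊩-⋀⁺ : ∀ {v} (κs : List (PosBool n)) → All (v ⊩_) κs → v ⊩ ⋀ κs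
  ⊩-⋀⁺ []       []       = refl
  ⊩-⋀⁺ (κ ∷ κs) (p ∷ ps) = ⊩-∧ κ (⋀ κs) p (⊩-⋀⁺ κs ps)

  ⊩-⋀⁻ : ∀ {v} (κs : List (PosBool n)) → v ⊩ ⋀ κs → All (v ⊩_) κs
  ⊩-⋀⁻ []       p = []
  ⊩-⋀⁻ (κ ∷ κs) p = ∧-conicalˡ _ _ p ∷ ⊩-⋀⁻ κs (∧-conicalʳ _ _ p)

-- Annotated interpretations, their products, and passage to and from classical ones.

module _ {S : Signature} {n : ℕ} where

  module _ (I : AnnInterpretation S n) where
    open AnnInterpretation I

    roleExt-resp : ∀ P {d e κ κ′} → κ ≈ κ′ → roleExt P d e κ → roleExt P d e κ′
    roleExt-resp (name R) = role-resp
    roleExt-resp (R ⁻)    = role-resp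

    conceptExt-resp : ∀ C {d κ κ′} → κ ≈ κ′ → conceptExt C d κ → conceptExt C d κ′
    conceptExt-resp (name A)   p c = concept-resp p c
    conceptExt-resp (∃′ P ∙ C) p (e , κ₁ , κ₂ , q , c) = e , κ₁ , κ₂ , ≈-trans (≈-sym p) q , c
    conceptExt-resp (C ⊓ D)    p (κ₁ , κ₂ , q , c)     = κ₁ , κ₂ , ≈-trans (≈-sym p) q , c
    conceptExt-resp ⊤′         p q = ≈-trans (≈-sym p) q

    rhsExt-resp : ∀ D {d κ κ′} → κ ≈ κ′ → rhsExt D d κ → rhsExt D d κ′
    rhsExt-resp (basic B) = conceptExt-resp ⌜ B ⌝

    -- `⊤` carries only the annotation 1, so the second factor of the product vanishes.
    ∃⊤⁻ : ∀ P {d κ} → conceptExt (∃′ P ∙ ⊤′) d κ → Σ[ e ∈ Δ ] roleExt P d e κ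
    ∃⊤⁻ P (e , κ₁ , κ₂ , p , r , q) =
      e , roleExt-resp P (≈-sym (≈-trans p (≈-trans (∧-congʳ-≈ κ₁ q) (∧-identityʳ-≈ κ₁)))) r

    ∃⊤⁺ : ∀ P {d e} κ → roleExt P d e κ → conceptExt (∃′ P ∙ ⊤′) d κ
    ∃⊤⁺ P κ r = _ , κ , 1# , ≈-sym (∧-identityʳ-≈ κ) , r , λ _ → refl

    conceptExt-top : ∀ {C d κ} → IsTop C → κ ≈ 1# → conceptExt C d κ
    conceptExt-top top          p = p
    conceptExt-top (conj t₁ t₂) p =
      1# , 1# , p , conceptExt-top t₁ (λ _ → refl) , conceptExt-top t₂ (λ _ → refl)

    ⊨ₐ-resp : ∀ α {κ κ′} → κ ≈ κ′ → I ⊨ₐ α , κ → I ⊨ₐ α , κ′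
    ⊨ₐ-resp (axiom (conceptAssertion A a)) p = concept-resp p
    ⊨ₐ-resp (axiom (roleAssertion R a b))  p = role-resp p
    ⊨ₐ-resp (axiom (gci C D)) p h d κ c      =
      rhsExt-resp D (∧-congˡ-≈ κ p) (h d κ c)
    ⊨ₐ-resp (axiom (ri P Q)) p h d e κ r     =
      roleExt-resp Q (∧-congˡ-≈ κ p) (h d e κ r)
    ⊨ₐ-resp (axiom (negRi P Q)) p h          = h
    ⊨ₐ-resp (bcq q) p (π , κs , hs , eq)     = π , κs , hs , ≈-trans (≈-sym p) eq

  module Product {K : Set} (k₀ : K) (F : K → AnnInterpretation S n) where

    ∏ : AnnInterpretation S n
    ∏ = record
      { Δ            = ∀ k → 𝔸.Δ (F k)
      ; nonempty     = λ k → 𝔸.nonempty (F k)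
      ; individual   = λ a k → 𝔸.individual (F k) a
      ; concept      = λ A d κ → ∀ k → 𝔸.concept (F k) A (d k) κ
      ; role         = λ R d e κ → ∀ k → 𝔸.role (F k) R (d k) (e k) κ
      ; concept-resp = λ p h k → 𝔸.concept-resp (F k) p (h k)
      ; role-resp    = λ p h k → 𝔸.role-resp (F k) p (h k)
      }

    roleExt⁻ : ∀ P {d e κ} → 𝔸.roleExt ∏ P d e κ → ∀ k → 𝔸.roleExt (F k) P (d k) (e k) κ
    roleExt⁻ (name R) h = h
    roleExt⁻ (R ⁻)    h = h

    roleExt⁺ : ∀ P {d e κ} → (∀ k → 𝔸.roleExt (F k) P (d k) (e k) κ) → 𝔸.roleExt ∏ P d e κ
    roleExt⁺ (name R) h = h
    roleExt⁺ (R ⁻)    h = h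

    conceptExt⁻ : ∀ C {d κ} → 𝔸.conceptExt ∏ C d κ → ∀ k → 𝔸.conceptExt (F k) C (d k) κ
    conceptExt⁻ (name A) h k = h k
    conceptExt⁻ (∃′ P ∙ C) (e , κ₁ , κ₂ , p , r , c) k =
      e k , κ₁ , κ₂ , p , roleExt⁻ P r k , conceptExt⁻ C c k
    conceptExt⁻ (C ⊓ D) (κ₁ , κ₂ , p , c , d) k =
      κ₁ , κ₂ , p , conceptExt⁻ C c k , conceptExt⁻ D d k
    conceptExt⁻ ⊤′ h k = h

    -- For a general concept the factors may split `κ` differently, and the pieces need not match
    -- up. A basic concept leaves no such freedom, and only basic concepts or `⊥′` occur on the
    -- right of a GCI.
    basicExt⁺ : ∀ B {d} κ → (∀ k → 𝔸.conceptExt (F k) ⌜ B ⌝ (d k) κ) → 𝔸.conceptExt ∏ ⌜ B ⌝ d κ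
    basicExt⁺ (name A) κ h = h
    basicExt⁺ (∃′ P)   κ h = ∃⊤⁺ ∏ P {e = λ k → proj₁ (∃⊤⁻ (F k) P {κ = κ} (h k))} κ
                             (roleExt⁺ P λ k → proj₂ (∃⊤⁻ (F k) P (h k)))

    -- The index `k₀` serves the axioms with ⊥: an empty product would contain every fact and
    -- violate them.
    ∏-satisfies : ∀ β κ → (∀ k → F k ⊨ₐ axiom β , κ) → ∏ ⊨ₐ axiom β , κ
    ∏-satisfies (conceptAssertion A a) κ h = h
    ∏-satisfies (roleAssertion R a b)  κ h = h
    ∏-satisfies (gci C (basic B)) κ h d κ′ c =
      basicExt⁺ B (κ ∧ κ′) λ k → h k (d k) κ′ (conceptExt⁻ C c k)
    ∏-satisfies (gci C ⊥′) κ h d κ′ c = h k₀ (d k₀) κ′ (conceptExt⁻ C c k₀)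
    ∏-satisfies (ri P Q) κ h d e κ′ r = roleExt⁺ Q λ k → h k (d k) (e k) κ′ (roleExt⁻ P r k)
    ∏-satisfies (negRi P Q) κ h d e κ′ (κ₁ , κ₂ , p , r , s) =
      h k₀ (d k₀) (e k₀) κ′ (κ₁ , κ₂ , p , roleExt⁻ P r k₀ , roleExt⁻ Q s k₀)

    term⁻ : ∀ {m} (π : Fin m → 𝔸.Δ ∏) t k → 𝔸.term ∏ π t k ≡ 𝔸.term (F k) (λ x → π x k) t
    term⁻ π (inj₁ a) k = refl
    term⁻ π (inj₂ x) k = refl

    atomHolds⁻ : ∀ {m} {π : Fin m → 𝔸.Δ ∏} α {κ} → 𝔸.atomHolds ∏ π α κ →
                 ∀ k → 𝔸.atomHolds (F k) (λ x → π x k) α κ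
    atomHolds⁻ {π = π} (conceptAtom A t) h k rewrite sym (term⁻ π t k) = h k
    atomHolds⁻ {π = π} (roleAtom R t t′) h k
      rewrite sym (term⁻ π t k) | sym (term⁻ π t′ k) = h k

    atomsHold⁻ : ∀ {m} {π : Fin m → 𝔸.Δ ∏} {αs κs} → Pointwise (𝔸.atomHolds ∏ π) αs κs →
                 ∀ k → Pointwise (𝔸.atomHolds (F k) (λ x → π x k)) αs κs
    atomsHold⁻ []                 k = []
    atomsHold⁻ (_∷_ {x = α} h hs) k = atomHolds⁻ α h k ∷ atomsHold⁻ hs k

  module Restriction (φ : PosBool n → Set) (φ-1 : φ 1#)
                     (φ-∧ : ∀ κ κ′ → φ κ → φ κ′ → φ (κ ∧ κ′))
                     (I : AnnInterpretation S n) where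

    -- `φ` selects the annotations that count as present: those true under `v` in one use, all of
    -- them in the other. Annotations of compound concepts are products, hence the closure
    -- conditions on `φ`.
    restriction : Interpretation S
    restriction = record
      { Δ          = 𝔸.Δ I
      ; nonempty   = 𝔸.nonempty I
      ; individual = 𝔸.individual I
      ; concept    = λ A d → ∃[ κ ] (φ κ × 𝔸.concept I A d κ)
      ; role       = λ R d e → ∃[ κ ] (φ κ × 𝔸.role I R d e κ)
      }

    roleExt⁻ : ∀ P {d e} → ℂ.roleExt restriction P d e → ∃[ κ ] (φ κ × 𝔸.roleExt I P d e κ)
    roleExt⁻ (name R) h = h
    roleExt⁻ (R ⁻)    h = h

    roleExt⁺ : ∀ P {d e} κ → φ κ → 𝔸.roleExt I P d e κ → ℂ.roleExt restriction P d e
    roleExt⁺ (name R) κ t h = κ , t , h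
    roleExt⁺ (R ⁻)    κ t h = κ , t , h

    conceptExt⁻ : ∀ C {d} → ℂ.conceptExt restriction C d → ∃[ κ ] (φ κ × 𝔸.conceptExt I C d κ)
    conceptExt⁻ (name A) h = h
    conceptExt⁻ (∃′ P ∙ C) (e , r , c)
      with κ₁ , t₁ , r′ ← roleExt⁻ P r | κ₂ , t₂ , c′ ← conceptExt⁻ C c
      = κ₁ ∧ κ₂ , φ-∧ κ₁ κ₂ t₁ t₂ , e , κ₁ , κ₂ , (λ _ → refl) , r′ , c′
    conceptExt⁻ (C ⊓ D) (c , d)
      with κ₁ , t₁ , c′ ← conceptExt⁻ C c | κ₂ , t₂ , d′ ← conceptExt⁻ D d
      = κ₁ ∧ κ₂ , φ-∧ κ₁ κ₂ t₁ t₂ , κ₁ , κ₂ , (λ _ → refl) , c′ , d′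
    conceptExt⁻ ⊤′ _ = 1# , φ-1 , λ _ → refl

    basicExt⁺ : ∀ B {d} κ → φ κ → 𝔸.conceptExt I ⌜ B ⌝ d κ → ℂ.conceptExt restriction ⌜ B ⌝ d
    basicExt⁺ (name A) κ t c = κ , t , c
    basicExt⁺ (∃′ P)   κ t c with e , r ← ∃⊤⁻ I P c = e , roleExt⁺ P κ t r , tt

    restriction-satisfies : ∀ β κ → φ κ → I ⊨ₐ axiom β , κ → restriction ⊨ axiom β
    restriction-satisfies (conceptAssertion A a) κ t h = κ , t , h
    restriction-satisfies (roleAssertion R a b)  κ t h = κ , t , h
    restriction-satisfies (gci C (basic B)) κ t h d c with κ′ , t′ , c′ ← conceptExt⁻ C c =
      basicExt⁺ B (κ ∧ κ′) (φ-∧ κ κ′ t t′) (h d κ′ c′)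
    restriction-satisfies (gci C ⊥′) κ t h d c with κ′ , t′ , c′ ← conceptExt⁻ C c = h d κ′ c′
    restriction-satisfies (ri P Q) κ t h d e r with κ′ , t′ , r′ ← roleExt⁻ P r =
      roleExt⁺ Q (κ ∧ κ′) (φ-∧ κ κ′ t t′) (h d e κ′ r′)
    restriction-satisfies (negRi P Q) κ t h d e (r , s)
      with κ₁ , _ , r′ ← roleExt⁻ P r | κ₂ , _ , s′ ← roleExt⁻ Q s
      = h d e (κ₁ ∧ κ₂) (κ₁ , κ₂ , (λ _ → refl) , r′ , s′)

    atomsHold⁻ : ∀ {m} {π : Fin m → 𝔸.Δ I} {αs} → All (ℂ.atomHolds restriction π) αs →
                 ∃[ κs ] (Pointwise (𝔸.atomHolds I π) αs κs × All φ κs)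
    atomsHold⁻ [] = [] , [] , []
    atomsHold⁻ (_∷_ {x = conceptAtom A t} (κ , p , h) hs) with κs , hs′ , ps ← atomsHold⁻ hs =
      κ ∷ κs , h ∷ hs′ , p ∷ ps
    atomsHold⁻ (_∷_ {x = roleAtom R t t′} (κ , p , h) hs) with κs , hs′ , ps ← atomsHold⁻ hs =
      κ ∷ κs , h ∷ hs′ , p ∷ ps

  module Mask (v : Vec Bool n) (I M : Interpretation S) where

    mask : AnnInterpretation S n
    mask = record
      { Δ            = ℂ.Δ I × ℂ.Δ M
      ; nonempty     = ℂ.nonempty I , ℂ.nonempty M
      ; individual   = λ a → ℂ.individual I a , ℂ.individual M a
      ; concept      = λ { A (d , m) κ → (v ⊩ κ → ℂ.concept I A d) × ℂ.concept M A m }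
      ; role         = λ { R (d , m) (e , m′) κ → (v ⊩ κ → ℂ.role I R d e) × ℂ.role M R m m′ }
      ; concept-resp = λ p (h , h′) → (λ t → h (trans (p v) t)) , h′
      ; role-resp    = λ p (h , h′) → (λ t → h (trans (p v) t)) , h′
      }

    roleExt⁻ : ∀ P {d m e m′ κ} → 𝔸.roleExt mask P (d , m) (e , m′) κ →
               (v ⊩ κ → ℂ.roleExt I P d e) × ℂ.roleExt M P m m′
    roleExt⁻ (name R) h = h
    roleExt⁻ (R ⁻)    h = h

    roleExt⁺ : ∀ P {d m e m′ κ} → (v ⊩ κ → ℂ.roleExt I P d e) → ℂ.roleExt M P m m′ →
               𝔸.roleExt mask P (d , m) (e , m′) κ
    roleExt⁺ (name R) h h′ = h , h′
    roleExt⁺ (R ⁻)    h h′ = h , h′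

    conceptExt⁻ : ∀ C {d m κ} → 𝔸.conceptExt mask C (d , m) κ →
                  (v ⊩ κ → ℂ.conceptExt I C d) × ℂ.conceptExt M C m
    conceptExt⁻ (name A) h = h
    conceptExt⁻ (∃′ P ∙ C) ((e , m′) , κ₁ , κ₂ , p , r , c)
      with r₁ , r₂ ← roleExt⁻ P r | c₁ , c₂ ← conceptExt⁻ C c
      = (λ t → let t′ = trans (sym (p v)) t in
                e , r₁ (∧-conicalˡ _ _ t′) , c₁ (∧-conicalʳ (⟦ κ₁ ⟧ v) _ t′))
      , m′ , r₂ , c₂
    conceptExt⁻ (C ⊓ D) (κ₁ , κ₂ , p , c , d)
      with c₁ , c₂ ← conceptExt⁻ C c | d₁ , d₂ ← conceptExt⁻ D d
      = (λ t → let t′ = trans (sym (p v)) t in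
                c₁ (∧-conicalˡ _ _ t′) , d₁ (∧-conicalʳ (⟦ κ₁ ⟧ v) _ t′))
      , c₂ , d₂
    conceptExt⁻ ⊤′ h = _

    basicExt⁺ : ∀ B {d m} κ → (v ⊩ κ → ℂ.conceptExt I ⌜ B ⌝ d) → ℂ.conceptExt M ⌜ B ⌝ m →
                𝔸.conceptExt mask ⌜ B ⌝ (d , m) κ
    basicExt⁺ (name A) κ h h′ = h , h′
    basicExt⁺ (∃′ P) κ h (m′ , r′ , _) with ⟦ κ ⟧ v in eq
    -- Nothing is claimed about `I` when `κ` is false under `v`, so an arbitrary element of `I` can
    -- accompany the successor in `M`.
    ... | false = ∃⊤⁺ mask P {e = ℂ.nonempty I , m′} κ
                    (roleExt⁺ P (λ t → contradiction (trans (sym eq) t) λ ()) r′)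
    ... | true with e , r , _ ← h refl = ∃⊤⁺ mask P κ (roleExt⁺ P (λ _ → r) r′)

    -- Positive axioms pass to the first component because a product true under `v` has both factors
    -- true under `v`. Axioms with ⊥ are refuted in `M`, since `I` may violate those whose label is
    -- false.
    mask-satisfies : ∀ β κ → (v ⊩ κ → I ⊨ axiom β) → M ⊨ axiom β → mask ⊨ₐ axiom β , κ
    mask-satisfies (conceptAssertion A a) κ h h′ = h , h′
    mask-satisfies (roleAssertion R a b)  κ h h′ = h , h′
    mask-satisfies (gci C (basic B)) κ h h′ (d , m) κ′ c with c₁ , c₂ ← conceptExt⁻ C c =
      basicExt⁺ B (κ ∧ κ′)
        (λ t → h (∧-conicalˡ _ _ t) d (c₁ (∧-conicalʳ (⟦ κ ⟧ v) _ t))) (h′ m c₂)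
    mask-satisfies (gci C ⊥′) κ h h′ (d , m) κ′ c = h′ m (proj₂ (conceptExt⁻ C c))
    mask-satisfies (ri P Q) κ h h′ (d , m) (e , m′) κ′ r with r₁ , r₂ ← roleExt⁻ P r =
      roleExt⁺ Q
        (λ t → h (∧-conicalˡ _ _ t) d e (r₁ (∧-conicalʳ (⟦ κ ⟧ v) _ t))) (h′ m m′ r₂)
    mask-satisfies (negRi P Q) κ h h′ (d , m) (e , m′) κ′ (_ , _ , _ , r , s) =
      h′ m m′ (proj₂ (roleExt⁻ P r) , proj₂ (roleExt⁻ Q s))

    term⁻ : ∀ {k} (π : Fin k → 𝔸.Δ mask) t → proj₁ (𝔸.term mask π t) ≡ ℂ.term I (proj₁ ∘ π) t
    term⁻ π (inj₁ a) = refl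
    term⁻ π (inj₂ x) = refl

    atomHolds⁻ : ∀ {k} (π : Fin k → 𝔸.Δ mask) α {κ} → 𝔸.atomHolds mask π α κ →
                 v ⊩ κ → ℂ.atomHolds I (proj₁ ∘ π) α
    atomHolds⁻ π (conceptAtom A t) h p rewrite sym (term⁻ π t) = proj₁ h p
    atomHolds⁻ π (roleAtom R t t′) h p rewrite sym (term⁻ π t) | sym (term⁻ π t′) = proj₁ h p

    atomsHold⁻ : ∀ {k} (π : Fin k → 𝔸.Δ mask) {αs κs} → Pointwise (𝔸.atomHolds mask π) αs κs →
                 All (v ⊩_) κs → All (ℂ.atomHolds I (proj₁ ∘ π)) αs
    atomsHold⁻ π [] [] = []
    atomsHold⁻ π (_∷_ {x = α} h hs) (p ∷ ps) = atomHolds⁻ π α h p ∷ atomsHold⁻ π hs ps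

  -- Reannotation of an interpretation by weighted copies.

  -- Copies of I indexed by tags: an edge of I with annotation κ ∧ δ becomes an
  -- edge with annotation κ from copy i to copy j whenever E i j δ holds.
  record Reweighting : Set₁ where
    field
      Tag     : Set
      E       : Tag → Tag → PosBool n → Set
      E-resp  : ∀ {i j δ δ′} → δ ≈ δ′ → E i j δ → E i j δ′
      E-sym   : ∀ {i j δ} → E i j δ → E j i δ
      E-trans : ∀ {i j k δ δ′} → E i j δ → E j k δ′ → E i k (δ ∧ δ′)
      base    : Tag
      E-base  : E base base 1#

    -- Going from `i` to `j` and back costs `δ ∧ δ`, which is `δ` by idempotence.
    E-left : ∀ {i j δ} → E i j δ → E i i δ
    E-left {δ = δ} w = E-resp (∧-idem-≈ δ) (E-trans w (E-sym w))

  module Reannotation (W : Reweighting) (I : AnnInterpretation S n) where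
    open Reweighting W

    reannotation : AnnInterpretation S n
    reannotation = record
      { Δ            = 𝔸.Δ I × Tag
      ; nonempty     = 𝔸.nonempty I , base
      -- At `base` the weight 1 is available, so assertions keep their annotations.
      ; individual   = λ a → 𝔸.individual I a , base
      ; concept      = λ { A (d , i) κ → ∃[ δ ] (E i i δ × 𝔸.concept I A d (κ ∧ δ)) }
      ; role         = λ { R (d , i) (e , j) κ → ∃[ δ ] (E i j δ × 𝔸.role I R d e (κ ∧ δ)) }
      ; concept-resp = λ p (δ , w , h) →
                         δ , w , 𝔸.concept-resp I (∧-congˡ-≈ δ p) h
      ; role-resp    = λ p (δ , w , h) →
                         δ , w , 𝔸.role-resp I (∧-congˡ-≈ δ p) h
      }

    roleExt⁻ : ∀ P {d i e j κ} → 𝔸.roleExt reannotation P (d , i) (e , j) κ →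
               ∃[ δ ] (E i j δ × 𝔸.roleExt I P d e (κ ∧ δ))
    roleExt⁻ (name R) h           = h
    roleExt⁻ (R ⁻)    (δ , w , h) = δ , E-sym w , h

    roleExt⁺ : ∀ P {d i e j κ} δ → E i j δ → 𝔸.roleExt I P d e (κ ∧ δ) →
               𝔸.roleExt reannotation P (d , i) (e , j) κ
    roleExt⁺ (name R) δ w h = δ , w , h
    roleExt⁺ (R ⁻)    δ w h = δ , E-sym w , h

    -- The weights met while evaluating `C` multiply to a single one that leads back to `i`. The
    -- exception is a conjunction of copies of `⊤′`: its annotation is 1 in every copy, and no
    -- weight is met.
    conceptExt⁻ : ∀ C {d i} κ → 𝔸.conceptExt reannotation C (d , i) κ →
                  (IsTop C × κ ≈ 1#) ⊎ ∃[ δ ] (E i i δ × 𝔸.conceptExt I C d (κ ∧ δ))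
    conceptExt⁻ (name A) κ h = inj₂ h
    conceptExt⁻ (∃′ P ∙ C) κ ((e , j) , κ₁ , κ₂ , p , r , c)
      with δ₁ , w₁ , r′ ← roleExt⁻ P r | conceptExt⁻ C κ₂ c
    ... | inj₁ (t , q) = inj₂
      ( δ₁ , E-left w₁ , e , κ₁ ∧ δ₁ , 1#
      , ≈-trans (∧-congˡ-≈ δ₁ (≈-trans p (≈-trans (∧-congʳ-≈ κ₁ q) (∧-identityʳ-≈ κ₁))))
                (≈-sym (∧-identityʳ-≈ (κ₁ ∧ δ₁)))
      , r′ , conceptExt-top I t (λ _ → refl))
    -- The weight is collected along the edge and at the successor, then again on the way back;
    -- idempotence absorbs the repetition.
    ... | inj₂ (δ₂ , w₂ , c′) = inj₂
      ( δ₁ ∧ δ₂ , E-resp (∧-idem-≈ (δ₁ ∧ δ₂)) (E-trans (E-trans w₁ w₂) (E-sym (E-trans w₁ w₂)))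
      , e , κ₁ ∧ δ₁ , κ₂ ∧ δ₂
      , ≈-trans (∧-congˡ-≈ (δ₁ ∧ δ₂) p) (∧-interchange-≈ κ₁ κ₂ δ₁ δ₂)
      , r′ , c′)
    conceptExt⁻ (C ⊓ D) κ (κ₁ , κ₂ , p , c , d) with conceptExt⁻ C κ₁ c | conceptExt⁻ D κ₂ d
    ... | inj₁ (t₁ , q₁) | inj₁ (t₂ , q₂) = inj₁ (conj t₁ t₂ , ≈-trans p (∧-cong-≈ q₁ q₂))
    ... | inj₁ (t₁ , q₁) | inj₂ (δ₂ , w₂ , d′) = inj₂
      ( δ₂ , w₂ , κ₁ , κ₂ ∧ δ₂
      , ≈-trans (∧-congˡ-≈ δ₂ p) (∧-assoc-≈ κ₁ κ₂ δ₂)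
      , conceptExt-top I t₁ q₁ , d′)
    ... | inj₂ (δ₁ , w₁ , c′) | inj₁ (t₂ , q₂) = inj₂
      ( δ₁ , w₁ , κ₁ ∧ δ₁ , κ₂
      , ≈-trans (∧-congˡ-≈ δ₁ (≈-trans p (∧-comm-≈ κ₁ κ₂)))
          (≈-trans (∧-assoc-≈ κ₂ κ₁ δ₁) (∧-comm-≈ κ₂ (κ₁ ∧ δ₁)))
      , c′ , conceptExt-top I t₂ q₂)
    ... | inj₂ (δ₁ , w₁ , c′) | inj₂ (δ₂ , w₂ , d′) = inj₂
      ( δ₁ ∧ δ₂ , E-trans w₁ w₂ , κ₁ ∧ δ₁ , κ₂ ∧ δ₂
      , ≈-trans (∧-congˡ-≈ (δ₁ ∧ δ₂) p) (∧-interchange-≈ κ₁ κ₂ δ₁ δ₂)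
      , c′ , d′)
    conceptExt⁻ ⊤′ κ h = inj₁ (top , h)

    -- No basic concept satisfies `IsTop`, so the exceptional case of `conceptExt⁻` cannot occur.
    basicExt⁻ : ∀ B {d i} κ → 𝔸.conceptExt reannotation ⌜ B ⌝ (d , i) κ →
                ∃[ δ ] (E i i δ × 𝔸.conceptExt I ⌜ B ⌝ d (κ ∧ δ))
    basicExt⁻ (name A) κ h = h
    basicExt⁻ (∃′ P) κ h with inj₂ h′ ← conceptExt⁻ (∃′ P ∙ ⊤′) κ h = h′

    basicExt⁺ : ∀ B {d i} κ δ → E i i δ → 𝔸.conceptExt I ⌜ B ⌝ d (κ ∧ δ) →
                𝔸.conceptExt reannotation ⌜ B ⌝ (d , i) κ
    basicExt⁺ (name A) κ δ w h = δ , w , h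
    basicExt⁺ (∃′ P) κ δ w h with e , r ← ∃⊤⁻ I P h = ∃⊤⁺ reannotation P κ (roleExt⁺ P δ w r)

    -- The weight of the premise is passed on to the conclusion. A GCI from ⊤ has no weight to pass
    -- on and fires in every copy, so each copy must then offer the weight 1.
    reannotation-satisfies : ∀ β κ → (∀ C D → β ≡ gci C D → IsTop C → ∀ i → E i i 1#) →
                             I ⊨ₐ axiom β , κ → reannotation ⊨ₐ axiom β , κ
    reannotation-satisfies (conceptAssertion A a) κ _ h =
      1# , E-base , 𝔸.concept-resp I (≈-sym (∧-identityʳ-≈ κ)) h
    reannotation-satisfies (roleAssertion R a b) κ _ h =
      1# , E-base , 𝔸.role-resp I (≈-sym (∧-identityʳ-≈ κ)) h
    reannotation-satisfies (gci C (basic B)) κ tops h (d , i) κ′ c with conceptExt⁻ C κ′ c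
    ... | inj₁ (t , q) =
      basicExt⁺ B (κ ∧ κ′) 1# (tops C _ refl t i)
        (conceptExt-resp I ⌜ B ⌝ (≈-sym (∧-identityʳ-≈ (κ ∧ κ′))) (h d κ′ (conceptExt-top I t q)))
    ... | inj₂ (δ , w , c′) =
      basicExt⁺ B (κ ∧ κ′) δ w (conceptExt-resp I ⌜ B ⌝ (≈-sym (∧-assoc-≈ κ κ′ δ)) (h d (κ′ ∧ δ) c′))
    reannotation-satisfies (gci C ⊥′) κ tops h (d , i) κ′ c with conceptExt⁻ C κ′ c
    ... | inj₁ (t , q)      = h d κ′ (conceptExt-top I t q)
    ... | inj₂ (δ , w , c′) = h d (κ′ ∧ δ) c′
    reannotation-satisfies (ri P Q) κ _ h (d , i) (e , j) κ′ r with δ , w , r′ ← roleExt⁻ P r =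
      roleExt⁺ Q δ w (roleExt-resp I Q (≈-sym (∧-assoc-≈ κ κ′ δ)) (h d e (κ′ ∧ δ) r′))
    reannotation-satisfies (negRi P Q) κ _ h (d , i) (e , j) κ′ (κ₁ , κ₂ , _ , r , s)
      with δ₁ , _ , r′ ← roleExt⁻ P r | δ₂ , _ , s′ ← roleExt⁻ Q s
      = h d e ((κ₁ ∧ δ₁) ∧ (κ₂ ∧ δ₂)) (κ₁ ∧ δ₁ , κ₂ ∧ δ₂ , (λ _ → refl) , r′ , s′)

  -- Two disjoint copies.  In the second one κ₀ plays the role of 1, but ⊤ keeps
  -- the annotation 1, which is why GCIs with left-hand side ⊤ are excluded.
  shifted : PosBool n → Reweighting
  shifted κ₀ = record
    { Tag     = Bool
    ; E       = λ i j δ → i ≡ j × δ ≈ (if i then κ₀ else 1#)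
    ; E-resp  = λ p (q , r) → q , ≈-trans (≈-sym p) r
    ; E-sym   = λ { (refl , r) → refl , r }
    ; E-trans = λ { {i} (refl , r) (refl , s) →
                      refl , ≈-trans (∧-cong-≈ r s) (∧-idem-≈ (if i then κ₀ else 1#)) }
    ; base    = false
    ; E-base  = refl , λ _ → refl
    }

  -- Two copies of I in which facts may also drop κ₀ from their annotation.  The
  -- edges between the copies have to drop it, so an RI that holds on them with
  -- annotation κ holds in I with κ ∧ κ₀; GCIs from ⊤ are harmless here.
  bridged : PosBool n → Reweighting
  bridged κ₀ = record
    { Tag     = Bool
    ; E       = λ i j δ → (i ≡ j × δ ≈ 1#) ⊎ δ ≈ κ₀
    ; E-resp  = λ { p (inj₁ (q , r)) → inj₁ (q , ≈-trans (≈-sym p) r)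
                  ; p (inj₂ r)       → inj₂ (≈-trans (≈-sym p) r) }
    ; E-sym   = λ { (inj₁ (refl , r)) → inj₁ (refl , r) ; (inj₂ r) → inj₂ r }
    ; E-trans = λ { (inj₁ (refl , r)) (inj₁ (refl , s)) → inj₁ (refl , ∧-cong-≈ r s)
                  ; (inj₁ (refl , r)) (inj₂ s)          → inj₂ (∧-cong-≈ r s)
                  ; (inj₂ r)          (inj₁ (refl , s)) →
                      inj₂ (≈-trans (∧-cong-≈ r s) (∧-identityʳ-≈ κ₀))
                  ; (inj₂ r)          (inj₂ s)          →
                      inj₂ (≈-trans (∧-cong-≈ r s) (∧-idem-≈ κ₀)) }
    ; base    = false
    ; E-base  = inj₁ (refl , λ _ → refl)
    }

-- The axioms true under a valuation, and soundness.

module _ {S : Signature} {n : ℕ} (O : AnnotatedOntology S n) where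
  open AnnotatedOntology O

  trueAxioms : Vec Bool n → Subset size
  trueAxioms v = tabulate λ i → ⟦ ⟪ label i ⟫ ⟧ v

  ∈-trueAxioms⁺ : ∀ {v i} → v ⊩ ⟪ label i ⟫ → i ∈ trueAxioms v
  ∈-trueAxioms⁺ {v} {i} t = lookup⇒[]= i _ (trans (lookup∘tabulate _ i) t)

  ∈-trueAxioms⁻ : ∀ {v i} → i ∈ trueAxioms v → v ⊩ ⟪ label i ⟫
  ∈-trueAxioms⁻ {v} {i} i∈ = trans (sym (lookup∘tabulate _ i)) ([]=⇒lookup i∈)

  labels : Subset size → List (PosBool n)
  labels J = map (λ i → ⟪ label i ⟫) (filter (_∈? J) (allFin size))

  ⊩-⋀label⁺ : ∀ {v} J → J ⊆ trueAxioms v → v ⊩ ⋀label O J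
  ⊩-⋀label⁺ J J⊆ =
    ⊩-⋀⁺ (labels J) (All.map⁺ (All.tabulate λ i∈ →
      ∈-trueAxioms⁻ (J⊆ (proj₂ (∈-filter⁻ (_∈? J) {xs = allFin size} i∈)))))

  ⊩-⋀label⁻ : ∀ {v} J → v ⊩ ⋀label O J → J ⊆ trueAxioms v
  ⊩-⋀label⁻ J t {i} i∈ =
    ∈-trueAxioms⁺ (All.lookup (All.map⁻ (⊩-⋀⁻ (labels J) t)) (∈-filter⁺ (_∈? J) (∈-allFin i) i∈))

  -- With `φ` constantly true the annotations are forgotten, which gives a classical model of all
  -- axioms, including those whose label is false under `v`.
  module Projection (M : AnnInterpretation S n) (M⊨O : IsModel O M) where
    open Restriction (λ _ → ⊤) tt (λ _ _ _ _ → tt) M public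

    restriction-models : ∀ i → restriction ⊨ axiom (axiomAt i)
    restriction-models i = restriction-satisfies (axiomAt i) ⟪ label i ⟫ tt (M⊨O i)

  -- For assertions and queries any annotated model can be the second factor of the mask. For
  -- inclusions it is a model realising the left-hand side, so that pairing its witnesses with the
  -- given elements of `I` triggers the entailed inclusion at annotation 1.
  sound : ∀ α {v} κ → Satisfiable O → Admissible O α → v ⊩ κ → AnnEntails O α κ →
          Entails ontology (trueAxioms v) α
  sound α {v} κ (M₀ , M₀⊨O) adm t O⊨α I I⊨ = holds α adm O⊨α
    where
    mask-models : ∀ M M⊨O → IsModel O (Mask.mask v I (Projection.restriction M M⊨O))
    mask-models M M⊨O i =
      Mask.mask-satisfies v I _ (axiomAt i) ⟪ label i ⟫
        (λ t → I⊨ i (∈-trueAxioms⁺ t)) (Projection.restriction-models M M⊨O i)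

    ⊩-∧-1 : v ⊩ κ ∧ 1#
    ⊩-∧-1 = ⊩-∧ κ 1# t refl

    holds : ∀ α → Admissible O α → AnnEntails O α κ → I ⊨ α
    holds _ (bcq q) h with π , κs , hs , eq ← h _ (mask-models M₀ M₀⊨O) =
      proj₁ ∘ π , Mask.atomsHold⁻ v I _ π hs (⊩-⋀⁻ κs (trans (sym (eq v)) t))
    holds _ (conceptAssertion A a) h = proj₁ (h _ (mask-models M₀ M₀⊨O)) t
    holds _ (roleAssertion R a b)  h = proj₁ (h _ (mask-models M₀ M₀⊨O)) t
    holds _ (ri P Q (M , M⊨O , m , m′ , κ′ , s)) h d e r =
      proj₁ (roleExt⁻ Q (h mask (mask-models M M⊨O) (d , m) (e , m′) 1#
                           (roleExt⁺ P (λ _ → r) (Pr.roleExt⁺ P κ′ tt s)))) ⊩-∧-1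
      where
      module Pr = Projection M M⊨O
      open Mask v I Pr.restriction
    -- The model realising `P ⊓ Q` already contradicts the annotated entailment.
    holds _ (negRi P Q (M , M⊨O , m , m′ , κ′ , s)) h =
      contradiction s (h M M⊨O m m′ κ′)
    holds _ (gci B B′ (M , M⊨O , m , κ′ , s) _) h d c =
      proj₁ (conceptExt⁻ ⌜ B′ ⌝ (h mask (mask-models M M⊨O) (d , m) 1#
                           (basicExt⁺ B 1# (λ _ → c) (Pr.basicExt⁺ B κ′ tt s)))) ⊩-∧-1
      where
      module Pr = Projection M M⊨O
      open Mask v I Pr.restriction

  -- Completeness: from classical to annotated entailment.

  module _ (em : ExcludedMiddle (lsuc 0ℓ)) where

    dne : {X : Set₁} → ¬ ¬ X → X
    dne = decidable-stable em

    dne₀ : {X : Set} → ¬ ¬ X → X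
    dne₀ = decidable-stable (map′ lower lift em)

    -- If no `κ` true under `v` is entailed, double-negation elimination at each such `κ` yields a
    -- whole family of counterexamples, which is then tupled and refuted.
    countermodels : ∀ α {v} (Counter : PosBool n → Set₁) →
                    (∀ κ → ¬ Counter κ → AnnEntails O α κ) →
                    ¬ ((k : ∃[ κ ] v ⊩ κ) → Counter (proj₁ k)) →
                    ∃[ κ ] (v ⊩ κ × AnnEntails O α κ)
    countermodels α Counter entails ¬all =
      dne λ ¬h → ¬all λ (κ , t) → dne λ ¬c → ¬h (κ , t , entails κ ¬c)

    module _ {v : Vec Bool n} where

      -- A fact of `restriction` has one annotation, true under `v`, that is valid in all factors at
      -- once. The factors are indexed by just these annotations, and 1 is one of them.
      module TrueFacts (F : (∃[ κ ] v ⊩ κ) → AnnInterpretation S n)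
                       (F⊨O : ∀ k → IsModel O (F k)) where
        module ∏ = Product (1# , refl) F
        open Restriction (v ⊩_) refl ⊩-∧ ∏.∏ public

        restriction-models : ∀ i → i ∈ trueAxioms v → restriction ⊨ axiom (axiomAt i)
        restriction-models i i∈ =
          restriction-satisfies (axiomAt i) ⟪ label i ⟫ (∈-trueAxioms⁻ i∈)
            (∏.∏-satisfies (axiomAt i) ⟪ label i ⟫ λ k → F⊨O k i)

      module _ (α : Query S) (Ov⊨α : Entails ontology (trueAxioms v) α) where

        -- A diagonal argument: `reflect` turns truth of `α` into an annotation `κ` shared by all
        -- factors, but the factor with index `κ` was chosen to refute precisely `κ`.
        complete-positive :
          (∀ F F⊨O → let open TrueFacts F F⊨O in
             restriction ⊨ α → ∃[ κ ] (v ⊩ κ × ∀ k → F k ⊨ₐ α , κ)) →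
          ∃[ κ ] (v ⊩ κ × AnnEntails O α κ)
        complete-positive reflect = countermodels α
          (λ κ → Σ[ I ∈ AnnInterpretation S n ] (IsModel O I × ¬ (I ⊨ₐ α , κ)))
          (λ κ ¬c I I⊨O → dne₀ λ I⊭α → ¬c (I , I⊨O , I⊭α))
          (λ c → let F   = λ k → proj₁ (c k)
                     F⊨O = λ k → proj₁ (proj₂ (c k))
                     open TrueFacts F F⊨O
                     κ , t , h = reflect F F⊨O (Ov⊨α restriction restriction-models)
                 in proj₂ (proj₂ (c (κ , t))) (h (κ , t)))

      -- The annotation `κ₀` of the `P`-edge varies with the countermodel, so the edges may have no
      -- common annotation. Reannotated by `bridged` they all carry 1, and the diagonal argument
      -- applies to their tuple.
      complete-ri : ∀ P Q → Entails ontology (trueAxioms v) (axiom (ri P Q)) →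
                    ∃[ κ ] (v ⊩ κ × AnnEntails O (axiom (ri P Q)) κ)
      complete-ri P Q Ov⊨α = countermodels (axiom (ri P Q)) Counter
        (λ κ ¬c I I⊨O d e κ₀ r → dne₀ λ ¬q → ¬c (I , I⊨O , d , e , κ₀ , r , ¬q))
        refute
        where
        Counter : PosBool n → Set₁
        Counter κ = Σ[ I ∈ AnnInterpretation S n ]
          (IsModel O I × ∃[ d ] ∃[ e ] ∃[ κ₀ ]
             (𝔸.roleExt I P d e κ₀ × ¬ 𝔸.roleExt I Q d e (κ ∧ κ₀)))

        refute : ¬ ((k : ∃[ κ ] v ⊩ κ) → Counter (proj₁ k))
        refute c = absurd (roleExt⁻ Q (Ov⊨α restriction restriction-models left right
                             (roleExt⁺ P 1# refl (∏.roleExt⁺ P edge))))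
          where
          F : (∃[ κ ] v ⊩ κ) → AnnInterpretation S n
          F k with I , _ , _ , _ , κ₀ , _ ← c k = Reannotation.reannotation (bridged κ₀) I

          F⊨O : ∀ k → IsModel O (F k)
          F⊨O k i with I , I⊨O , _ , _ , κ₀ , _ ← c k =
            Reannotation.reannotation-satisfies (bridged κ₀) I (axiomAt i) ⟪ label i ⟫
              (λ _ _ _ _ _ → inj₁ (refl , λ _ → refl)) (I⊨O i)

          open TrueFacts F F⊨O

          -- The endpoints lie in different copies, which rules out the weight 1 between them.
          left right : ∀ k → 𝔸.Δ (F k)
          left k  with _ , _ , d , _ ← c k     = d , false
          right k with _ , _ , _ , e , _ ← c k = e , true

          edge : ∀ k → 𝔸.roleExt (F k) P (left k) (right k) 1#
          edge k with I , _ , _ , _ , κ₀ , r , _ ← c k =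
            Reannotation.roleExt⁺ (bridged κ₀) I P κ₀ (inj₂ λ _ → refl)
              (roleExt-resp I P (≈-sym (∧-identityˡ-≈ κ₀)) r)

          no-edge : ∀ k → ¬ 𝔸.roleExt (F k) Q (left k) (right k) (proj₁ k)
          no-edge k q with I , _ , _ , _ , κ₀ , _ , ¬q ← c k
                      with Reannotation.roleExt⁻ (bridged κ₀) I Q q
          -- Only the weight `κ₀` remains, so a `Q`-edge annotated `κ` comes from one annotated
          -- `κ ∧ κ₀` in the countermodel.
          ... | δ , inj₂ p , q′ = ¬q (roleExt-resp I Q (∧-congʳ-≈ (proj₁ k) p) q′)

          absurd : ¬ (∃[ κ ] (v ⊩ κ × 𝔸.roleExt ∏.∏ Q left right κ))
          absurd (κ , t , q) = no-edge (κ , t) (∏.roleExt⁻ Q q (κ , t))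

      -- A concept is evaluated at a single element, so the weight 1 cannot be excluded by
      -- separating endpoints. Instead `point` lies in the second copy of `shifted`, where `κ₀` is
      -- the only weight; `noTop` makes this copy respect the axioms.
      complete-gci : NoTopGCI ontology → ∀ B B′ →
                     Entails ontology (trueAxioms v) (axiom (gci ⌜ B ⌝ (basic B′))) →
                     ∃[ κ ] (v ⊩ κ × AnnEntails O (axiom (gci ⌜ B ⌝ (basic B′))) κ)
      complete-gci noTop B B′ Ov⊨α = countermodels (axiom (gci ⌜ B ⌝ (basic B′))) Counter
        (λ κ ¬c I I⊨O d κ₀ b → dne₀ λ ¬b′ → ¬c (I , I⊨O , d , κ₀ , b , ¬b′))
        refute
        where
        Counter : PosBool n → Set₁
        Counter κ = Σ[ I ∈ AnnInterpretation S n ]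
          (IsModel O I × ∃[ d ] ∃[ κ₀ ]
             (𝔸.conceptExt I ⌜ B ⌝ d κ₀ × ¬ 𝔸.conceptExt I ⌜ B′ ⌝ d (κ ∧ κ₀)))

        refute : ¬ ((k : ∃[ κ ] v ⊩ κ) → Counter (proj₁ k))
        refute c = absurd (conceptExt⁻ ⌜ B′ ⌝ (Ov⊨α restriction restriction-models point
                             (basicExt⁺ B 1# refl (∏.basicExt⁺ B 1# member))))
          where
          F : (∃[ κ ] v ⊩ κ) → AnnInterpretation S n
          F k with I , _ , _ , κ₀ , _ ← c k = Reannotation.reannotation (shifted κ₀) I

          F⊨O : ∀ k → IsModel O (F k)
          F⊨O k i with I , I⊨O , _ , κ₀ , _ ← c k =
            Reannotation.reannotation-satisfies (shifted κ₀) I (axiomAt i) ⟪ label i ⟫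
              (λ C D eq t → contradiction t (noTop i C D eq)) (I⊨O i)

          open TrueFacts F F⊨O

          point : ∀ k → 𝔸.Δ (F k)
          point k with _ , _ , d , _ ← c k = d , true

          member : ∀ k → 𝔸.conceptExt (F k) ⌜ B ⌝ (point k) 1#
          member k with I , _ , _ , κ₀ , b , _ ← c k =
            Reannotation.basicExt⁺ (shifted κ₀) I B 1# κ₀ (refl , λ _ → refl)
              (conceptExt-resp I ⌜ B ⌝ (≈-sym (∧-identityˡ-≈ κ₀)) b)

          no-member : ∀ k → ¬ 𝔸.conceptExt (F k) ⌜ B′ ⌝ (point k) (proj₁ k)
          no-member k b with I , _ , _ , κ₀ , _ , ¬b ← c k
                        with _ , (_ , p) , b′ ← Reannotation.basicExt⁻ (shifted κ₀) I B′ (proj₁ k) b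
            = ¬b (conceptExt-resp I ⌜ B′ ⌝ (∧-congʳ-≈ (proj₁ k) p) b′)

          absurd : ¬ (∃[ κ ] (v ⊩ κ × 𝔸.conceptExt ∏.∏ ⌜ B′ ⌝ point κ))
          absurd (κ , t , b) = no-member (κ , t) (∏.conceptExt⁻ ⌜ B′ ⌝ b (κ , t))

    complete : ∀ α {v} → Admissible O α → Entails ontology (trueAxioms v) α →
               ∃[ κ ] (v ⊩ κ × AnnEntails O α κ)
    complete _ (conceptAssertion A a) Ov⊨α = complete-positive (axiom (conceptAssertion A a)) Ov⊨α λ _ _ → id
    complete _ (roleAssertion R a b)  Ov⊨α = complete-positive (axiom (roleAssertion R a b)) Ov⊨α λ _ _ → id
    complete _ (bcq q) Ov⊨α = complete-positive (bcq q) Ov⊨α λ F F⊨O (π , hs) →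
      let open TrueFacts F F⊨O
          κs , hs′ , ts = atomsHold⁻ hs
      in ⋀ κs , ⊩-⋀⁺ κs ts , λ k → (λ x → π x k) , κs , ∏.atomsHold⁻ hs′ k , λ _ → refl
    complete _ (ri P Q _)         Ov⊨α = complete-ri P Q Ov⊨α
    complete _ (gci B B′ _ noTop) Ov⊨α = complete-gci noTop B B′ Ov⊨α
    complete _ (negRi P Q (M , M⊨O , d , e , _ , κ₁ , κ₂ , _ , r , s)) Ov⊨α =
      -- The projection of a model realising `P ⊓ Q` satisfies every axiom, which refutes the
      -- classical entailment.
      contradiction (roleExt⁺ P κ₁ tt r , roleExt⁺ Q κ₂ tt s)
        (Ov⊨α restriction (λ i _ → restriction-models i) d e)
      where open Projection M M⊨O

    -- Justifications and the two disjunctions.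

    justification : ∀ α J → Entails ontology J α →
                    ∃[ J′ ] (J′ ⊆ J × IsJustification ontology α J′)
    justification α J = go J (⊂-wellFounded J)
      where
      go : ∀ J → Acc _⊂_ J → Entails ontology J α →
           ∃[ J′ ] (J′ ⊆ J × IsJustification ontology α J′)
      -- Descend to proper subsets while one of them still entails `α`; finiteness ends the descent
      -- at a minimal set.
      go J (acc smaller) J⊨α with em {∃[ J′ ] (J′ ⊂ J × Entails ontology J′ α)}
      ... | yes (J′ , J′⊂J , J′⊨α) with J″ , J″⊆J′ , just ← go J′ (smaller J′⊂J) J′⊨α =
        J″ , ⊆-trans J″⊆J′ (p⊂q⇒p⊆q J′⊂J) , just
      ... | no minimal = J , ⊆-refl , J⊨α , λ J′ J′⊆J J′⊨α → ⊆-antisym J′⊆J λ {i} i∈J →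
        decidable-stable (i ∈? J′) λ i∉J′ → minimal (J′ , (J′⊆J , i , i∈J , i∉J′) , J′⊨α)

    -- The disjunction runs over listed representatives only, so `κ` is replaced by that of its
    -- class; annotated entailment respects `_≈_`.
    ⊩-𝒫⁺ : ∀ α {v} κ → v ⊩ κ → AnnEntails O α κ → v ⊩ 𝒫 em α O
    ⊩-𝒫⁺ α {v} κ t O⊨α with κ′ , κ′∈ , κ≈κ′ ← classes-complete κ =
      ⊩-⋁⁺ (lose (∈-filter⁺ (λ κ → em {AnnEntails O α κ}) κ′∈
                   λ I I⊨O → ⊨ₐ-resp I α κ≈κ′ (O⊨α I I⊨O))
                 (trans (sym (κ≈κ′ v)) t))

    ⊩-𝒫⁻ : ∀ α {v} → v ⊩ 𝒫 em α O → ∃[ κ ] (v ⊩ κ × AnnEntails O α κ)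
    ⊩-𝒫⁻ α t with κ , κ∈ , t′ ← find (⊩-⋁⁻ _ t) =
      κ , t′ , proj₂ (∈-filter⁻ (λ κ → em {AnnEntails O α κ}) {xs = classes n} κ∈)

    ⊩-Just⁺ : ∀ α {v} J → v ⊩ ⋀label O J → IsJustification ontology α J →
              v ⊩ ⋁ (map (⋀label O) (Just em ontology α))
    ⊩-Just⁺ α J t just =
      ⊩-⋁⁺ (Any.map⁺ (lose (∈-filter⁺ (λ J → em {IsJustification ontology α J})
                              (subsets-complete J) just) t))

    ⊩-Just⁻ : ∀ α {v} → v ⊩ ⋁ (map (⋀label O) (Just em ontology α)) →
              ∃[ J ] (v ⊩ ⋀label O J × IsJustification ontology α J)
    ⊩-Just⁻ α t with J , J∈ , t′ ← find (Any.map⁻ (⊩-⋁⁻ _ t)) =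
      J , t′ , proj₂ (∈-filter⁻ (λ J → em {IsJustification ontology α J}) {xs = subsets size} J∈)

proposition7p4 : (em : ExcludedMiddle (lsuc 0ℓ))
    (S : Signature) (n : ℕ) (O : AnnotatedOntology S n) (α : Query S) →
    Satisfiable O →
    Admissible O α →
    𝒫 em α O ≈ ⋁ (map (⋀label O) (Just em (AnnotatedOntology.ontology O) α))
-- Equality in the semiring is agreement under every valuation, and two truth values agree once each
-- implies the other.
proposition7p4 em S n O α sat adm v = ⇔→≡ (mk⇔ to from)
  where
  open AnnotatedOntology O

  to : v ⊩ 𝒫 em α O → v ⊩ ⋁ (map (⋀label O) (Just em ontology α))
  to t with κ , t′ , O⊨α ← ⊩-𝒫⁻ O em α t
       with J , J⊆ , just ← justification O em α (trueAxioms O v) (sound O α κ sat adm t′ O⊨α)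
    = ⊩-Just⁺ O em α J (⊩-⋀label⁺ O J J⊆) just

  from : v ⊩ ⋁ (map (⋀label O) (Just em ontology α)) → v ⊩ 𝒫 em α O
  -- If all labels of `J` are true under `v`, then `J` is contained in `trueAxioms O v`, which
  -- entails `α` by monotonicity.
  from t with J , t′ , J⊨α , _ ← ⊩-Just⁻ O em α t
         with κ , t″ , O⊨α ← complete O em α adm
                (λ I I⊨ → J⊨α I λ i i∈J → I⊨ i (⊩-⋀label⁻ O J t′ i∈J))
    = ⊩-𝒫⁺ O em α κ t″ O⊨α
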